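{- Let $\mathcal A\subseteq\mathbb N$, $L$ an environment and $T,U_1,U_2$ terms. If $L\vdash_{\mathcal A}T:U_1$ and $L\vdash_{\mathcal A}T:U_2$, then there exists a term $U_0$ such that $L\vdash U_1\to^{*0}U_0$ and $L\vdash U_2\to^{*0}U_0$.
   Context: Fix a nonempty set $\Sigma$ of sorts with decidable equality, an arbitrary function $\mathrm{next}:\Sigma\to\Sigma$, and a countably infinite set of variables. Terms and environments: $T,U,V,W ::= \star s \mid x \mid \mathrm{app}(V,T) \mid \lambda x{:}W.\,T \mid \mathrm{def}(x{=}V).\,T \mid \mathrm{cast}(U,T)$ ($s\in\Sigma$) and $L,K ::= \emptyset \mid K,x{:}W \mid K,x{=}V$. $\mathrm{app}(V,T)$ applies $T$ to $V$; $\lambda x{:}W.\,T$ (de Bruijn's abstraction) and $\mathrm{def}(x{=}V).\,T$ (local definition) bind $x$ in $T$; $\mathrm{cast}(U,T)$ annotates $T$ with expected type $U$; entries $x{:}W$ and $x{=}V$ bind $x$. Terms are modulo renaming of bound variables. Write $\mathsf{B}x[V]$ for either $\lambda x{:}V$ or $\mathrm{def}(x{=}V)$ and correspondingly $L,x[V]$ for $L,x{:}V$ resp. $L,x{=}V$. One step of bound rt-reduction $L\vdash T_1\to^nT_2$ is the smallest relation closed under: $L\vdash\mathrm{app}(V,\lambda x{:}W.\,T)\to^0\mathrm{def}(x{=}\mathrm{cast}(W,V)).\,T$; $K,x{=}V\vdash x\to^0V$; $L\vdash\mathrm{def}(x{=}V).\,T\to^0T$ if $x$ not free in $T$; $L\vdash\mathrm{app}(V,\mathrm{def}(x{=}W).\,T)\to^0\mathrm{def}(x{=}W).\,\mathrm{app}(V,T)$;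 $L\vdash\mathrm{cast}(U,T)\to^0T$; $L\vdash\star s\to^1\star\,\mathrm{next}(s)$; $K,x{:}W\vdash x\to^1W$; $L\vdash\mathrm{cast}(U,T)\to^1U$; if $K\vdash x\to^nT$, $y\neq x$, $y$ not free in $T$ then $K,y[V]\vdash x\to^nT$; if $L\vdash V_1\to^0V_2$ then $L\vdash\mathrm{app}(V_1,T)\to^0\mathrm{app}(V_2,T)$; if $L\vdash T_1\to^nT_2$ then $L\vdash\mathrm{app}(V,T_1)\to^n\mathrm{app}(V,T_2)$; if $L\vdash V_1\to^0V_2$ then $L\vdash\mathsf Bx[V_1].\,T\to^0\mathsf Bx[V_2].\,T$; if $L,x[V]\vdash T_1\to^nT_2$ then $L\vdash\mathsf Bx[V].\,T_1\to^n\mathsf Bx[V].\,T_2$; if $L\vdash U_1\to^0U_2$ then $L\vdash\mathrm{cast}(U_1,T)\to^0\mathrm{cast}(U_2,T)$; if $L\vdash T_1\to^0T_2$ then $L\vdash\mathrm{cast}(U,T_1)\to^0\mathrm{cast}(U,T_2)$; if $L\vdash U_1\to^1U_2$ and $L\vdash T_1\to^1T_2$ then $L\vdash\mathrm{cast}(U_1,T_1)\to^1\mathrm{cast}(U_2,T_2)$. $L\vdash T_1\to^{*n}T_2$ is the smallest relation with $L\vdash T\to^{*0}T$, containing single steps, and with $L\vdash T_1\to^{*n_1}T$, $L\vdash T\to^{*n_2}T_2$ implying $L\vdash T_1\to^{*n_1+n_2}T_2$. Validity $L\vdash_{\mathcal A}T$ is the smallest predicate closed under: $L\vdash_{\mathcal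 A}\star s$; if $K\vdash_{\mathcal A}V$ then $K,x[V]\vdash_{\mathcal A}x$; if $K\vdash_{\mathcal A}x$ and $y\neq x$ then $K,y[V]\vdash_{\mathcal A}x$; if $L\vdash_{\mathcal A}V$ and $L,x[V]\vdash_{\mathcal A}T$ then $L\vdash_{\mathcal A}\mathsf Bx[V].\,T$; if $L\vdash_{\mathcal A}U$, $L\vdash_{\mathcal A}T$ and some $U_0$ satisfies $L\vdash T\to^{*1}U_0$, $L\vdash U\to^{*0}U_0$, then $L\vdash_{\mathcal A}\mathrm{cast}(U,T)$; if $L\vdash_{\mathcal A}V$, $L\vdash_{\mathcal A}T$ and there are $n\in\mathcal A$, $x,W_0,U_0$ with $L\vdash T\to^{*n}\lambda x{:}W_0.\,U_0$ and $L\vdash V\to^{*1}W_0$, then $L\vdash_{\mathcal A}\mathrm{app}(V,T)$. The type judgment $L\vdash_{\mathcal A}T:U$ means $L\vdash_{\mathcal A}\mathrm{cast}(U,T)$. -}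

module Defs where

-- Terms and environments of the paper, represented with de Bruijn indices
-- (so "terms modulo renaming of bound variables" is built in).  The set of
-- sorts is the parameter S of the data types; next : S → S parameterises
-- bound rt-reduction and validity.

open import Data.Nat using (ℕ; zero; suc; _+_; _<ᵇ_)
open import Data.Bool using (if_then_else_)

-- binder kinds: abst = λx:W (de Bruijn's abstraction), abbr = def(x=V)
data Bind : Set where
  abst abbr : Bind

data Term (S : Set) : Set where
  sort : S → Term S
  lref : ℕ → Term S
  appl : Term S → Term S → Term S            -- app(V,T): T applied to V
  bind : Bind → Term S → Term S → Term S
  cast : Term S → Term S → Term S

-- environments: ∅ and  K , x[V]   (the last entry is referenced by index 0)
data Env (S : Set) : Set where
  ⋆      : Env S
  _,[_]_ : Env S → Bind → Term S → Env S

module _ {S : Set} where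

  liftAt : ℕ → Term S → Term S
  liftAt d (sort s)     = sort s
  liftAt d (lref i)     = if i <ᵇ d then lref i else lref (suc i)
  liftAt d (appl V T)   = appl (liftAt d V) (liftAt d T)
  liftAt d (bind b V T) = bind b (liftAt d V) (liftAt (suc d) T)
  liftAt d (cast U T)   = cast (liftAt d U) (liftAt d T)

  ↑ : Term S → Term S
  ↑ = liftAt 0

module _ {S : Set} (next : S → S) where

  data Step : Env S → ℕ → Term S → Term S → Set where
    beta  : ∀ {L V W T} → Step L 0 (appl V (bind abst W T)) (bind abbr (cast W V) T)
    delta : ∀ {K V} → Step (K ,[ abbr ] V) 0 (lref 0) (↑ V)
    zeta  : ∀ {L V T} → Step L 0 (bind abbr V (↑ T)) T
    theta : ∀ {L V W T} → Step L 0 (appl V (bind abbr W T)) (bind abbr W (appl (↑ V) T))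
    epsilon : ∀ {L U T} → Step L 0 (cast U T) T
    sortS : ∀ {L s} → Step L 1 (sort s) (sort (next s))
    ldec  : ∀ {K W} → Step (K ,[ abst ] W) 1 (lref 0) (↑ W)
    ee    : ∀ {L U T} → Step L 1 (cast U T) U
    lift  : ∀ {K b V i n T} → Step K n (lref i) T → Step (K ,[ b ] V) n (lref (suc i)) (↑ T)
    applV : ∀ {L V₁ V₂ T} → Step L 0 V₁ V₂ → Step L 0 (appl V₁ T) (appl V₂ T)
    applT : ∀ {L V T₁ T₂ n} → Step L n T₁ T₂ → Step L n (appl V T₁) (appl V T₂)
    bindV : ∀ {L b V₁ V₂ T} → Step L 0 V₁ V₂ → Step L 0 (bind b V₁ T) (bind b V₂ T)
    bindT : ∀ {L b V T₁ T₂ n} → Step (L ,[ b ] V) n T₁ T₂ → Step L n (bind b V T₁) (bind b V T₂)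
    castU : ∀ {L U₁ U₂ T} → Step L 0 U₁ U₂ → Step L 0 (cast U₁ T) (cast U₂ T)
    castT : ∀ {L U T₁ T₂} → Step L 0 T₁ T₂ → Step L 0 (cast U T₁) (cast U T₂)
    castE : ∀ {L U₁ U₂ T₁ T₂} → Step L 1 U₁ U₂ → Step L 1 T₁ T₂
          → Step L 1 (cast U₁ T₁) (cast U₂ T₂)

  data Steps : Env S → ℕ → Term S → Term S → Set where
    inj   : ∀ {L n T₁ T₂} → Step L n T₁ T₂ → Steps L n T₁ T₂
    refl* : ∀ {L T} → Steps L 0 T T
    trans* : ∀ {L n₁ n₂ T₁ T T₂} → Steps L n₁ T₁ T → Steps L n₂ T T₂
           → Steps L (n₁ + n₂) T₁ T₂

  data Valid (A : ℕ → Set) : Env S → Term S → Set where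
    vSort : ∀ {L s} → Valid A L (sort s)
    vZero : ∀ {K b V} → Valid A K V → Valid A (K ,[ b ] V) (lref 0)
    vLift : ∀ {K b V i} → Valid A K (lref i) → Valid A (K ,[ b ] V) (lref (suc i))
    vBind : ∀ {L b V T} → Valid A L V → Valid A (L ,[ b ] V) T → Valid A L (bind b V T)
    vCast : ∀ {L U T U₀} → Valid A L U → Valid A L T
          → Steps L 1 T U₀ → Steps L 0 U U₀ → Valid A L (cast U T)
    vAppl : ∀ {L V T n W₀ U₀} → Valid A L V → Valid A L T → A n
          → Steps L n T (bind abst W₀ U₀) → Steps L 1 V W₀ → Valid A L (appl V T)

  Typed : (A : ℕ → Set) → Env S → Term S → Term S → Set
  Typed A L T U = Valid A L (cast U T)

{-# OPTIONS --safe #-}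
module Submission where

-- A term T is interpreted as the sequence ⟦T⟧ whose k-th member is the k-fold
-- iterated type of T with all definitions unfolded and all casts erased.  The
-- members are pure λ-terms, except that an abstraction is annotated by the
-- whole sequence ⟦W⟧ of its domain W.  Convertibility of two abstractions thus
-- yields convertibility of all iterated types of their domains, which is what
-- makes subject reduction provable without strong normalization: on terms
-- whose casts and applications satisfy the expected conversions between
-- sequences, an n-step reduction drops the first n members of ⟦T⟧ (up to β)
-- and preserves these conversions.  Hence T : U gives ⟦U⟧ 0 ≃ ⟦T⟧ 1, so the two
-- types of T have β-convertible unfoldings.  By confluence of parallel
-- β-reduction these have a common reduct, and 0-reduction realizes both the
-- unfolding and the β-steps.

open import Defs
open import Data.Bool using (true; false; if_then_else_)
open import Data.Nat using (ℕ; zero; suc; _+_; _<ᵇ_)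
open import Data.Nat.Properties using (+-assoc; +-comm)
open import Data.Product using (Σ; _×_; _,_; ∃-syntax; proj₂)
open import Data.Unit using (⊤; tt)
open import Function using (_∘_; id)
open import Relation.Binary.Construct.Closure.Equivalence as Eq using (EqClosure)
open import Relation.Binary.Construct.Closure.ReflexiveTransitive as Star
  using (Star; ε; _◅_; _◅◅_)
open import Relation.Binary.Construct.Closure.Symmetric using (fwd; bwd)
open import Relation.Binary.Definitions using (DecidableEquality)
open import Relation.Binary.PropositionalEquality
  using (_≡_; _≗_; refl; sym; trans; cong; cong₂; subst)

-- Index maps and operations on sequences

ext : (ℕ → ℕ) → ℕ → ℕ
ext f zero    = zero
ext f (suc i) = suc (f i)

cons : ∀ {a} {A : Set a} → A → (ℕ → A) → ℕ → A
cons x s zero    = x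
cons x s (suc k) = s k

drop : ∀ {A : Set} → ℕ → (ℕ → A) → ℕ → A
drop m s k = s (m + k)

ext-cong : ∀ {f g} → f ≗ g → ext f ≗ ext g
ext-cong p zero    = refl
ext-cong p (suc i) = cong suc (p i)

ext-∘ : ∀ {f g h} → g ∘ f ≗ h → ext g ∘ ext f ≗ ext h
ext-∘ p zero    = refl
ext-∘ p (suc i) = cong suc (p i)

ext-id : ∀ {f} → f ≗ id → ext f ≗ id
ext-id p zero    = refl
ext-id p (suc i) = cong suc (p i)

-- Renaming of terms

module _ {S : Set} where

  ren : (ℕ → ℕ) → Term S → Term S
  ren f (sort s)     = sort s
  ren f (lref i)     = lref (f i)
  ren f (appl V T)   = appl (ren f V) (ren f T)
  ren f (bind b V T) = bind b (ren f V) (ren (ext f) T)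
  ren f (cast U T)   = cast (ren f U) (ren f T)

  ren-cong : ∀ T {f g} → f ≗ g → ren f T ≡ ren g T
  ren-cong (sort s)     p = refl
  ren-cong (lref i)     p = cong lref (p i)
  ren-cong (appl V T)   p = cong₂ appl (ren-cong V p) (ren-cong T p)
  ren-cong (bind b V T) p = cong₂ (bind b) (ren-cong V p) (ren-cong T (ext-cong p))
  ren-cong (cast U T)   p = cong₂ cast (ren-cong U p) (ren-cong T p)

  ren-∘ : ∀ T {f g h} → g ∘ f ≗ h → ren g (ren f T) ≡ ren h T
  ren-∘ (sort s)     p = refl
  ren-∘ (lref i)     p = cong lref (p i)
  ren-∘ (appl V T)   p = cong₂ appl (ren-∘ V p) (ren-∘ T p)
  ren-∘ (bind b V T) p = cong₂ (bind b) (ren-∘ V p) (ren-∘ T (ext-∘ p))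
  ren-∘ (cast U T)   p = cong₂ cast (ren-∘ U p) (ren-∘ T p)

  ren-id : ∀ T {f} → f ≗ id → ren f T ≡ T
  ren-id (sort s)     p = refl
  ren-id (lref i)     p = cong lref (p i)
  ren-id (appl V T)   p = cong₂ appl (ren-id V p) (ren-id T p)
  ren-id (bind b V T) p = cong₂ (bind b) (ren-id V p) (ren-id T (ext-id p))
  ren-id (cast U T)   p = cong₂ cast (ren-id U p) (ren-id T p)

  liftVar : ℕ → ℕ → ℕ
  liftVar d i = if i <ᵇ d then i else suc i

  liftVar-suc : ∀ d → liftVar (suc d) ≗ ext (liftVar d)
  liftVar-suc d zero    = refl
  liftVar-suc d (suc i) with i <ᵇ d
  ... | true  = refl
  ... | false = refl

  -- Makes lifting an instance of `ren`, so that commutation of lifts reduces to the fusion law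
  -- `ren-∘`.
  liftAt≡ren : ∀ d T → liftAt d T ≡ ren (liftVar d) T
  liftAt≡ren d (sort s) = refl
  liftAt≡ren d (lref i) with i <ᵇ d
  ... | true  = refl
  ... | false = refl
  liftAt≡ren d (appl V T)   = cong₂ appl (liftAt≡ren d V) (liftAt≡ren d T)
  liftAt≡ren d (bind b V T) = cong₂ (bind b) (liftAt≡ren d V)
    (trans (liftAt≡ren (suc d) T) (ren-cong T (liftVar-suc d)))
  liftAt≡ren d (cast U T)   = cong₂ cast (liftAt≡ren d U) (liftAt≡ren d T)

  ↑≡ren : ∀ T → ↑ T ≡ ren suc T
  ↑≡ren = liftAt≡ren 0

  ren-↑ : ∀ f T → ren (ext f) (↑ T) ≡ ↑ (ren f T)
  ren-↑ f T = trans (cong (ren (ext f)) (↑≡ren T))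
    (trans (ren-∘ T (λ _ → refl)) (sym (trans (↑≡ren (ren f T)) (ren-∘ T (λ _ → refl)))))

  ↑-ren : ∀ f T → ↑ (ren f T) ≡ ren (suc ∘ f) T
  ↑-ren f T = trans (↑≡ren _) (ren-∘ T (λ _ → refl))

-- Pure terms

data Pure (S : Set) : Set where
  sort : S → Pure S
  var  : ℕ → Pure S
  app  : Pure S → Pure S → Pure S
  lam  : (ℕ → Pure S) → Pure S → Pure S

module _ {S : Set} where

  -- Equality of pure terms without function extensionality.
  data _≈_ : Pure S → Pure S → Set where
    sort : ∀ {s} → sort s ≈ sort s
    var  : ∀ {i} → var i ≈ var i
    app  : ∀ {v v' t t'} → v ≈ v' → t ≈ t' → app v t ≈ app v' t'
    lam  : ∀ {w w' t t'} → (∀ k → w k ≈ w' k) → t ≈ t' → lam w t ≈ lam w' t'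

  ≈-refl : ∀ {a} → a ≈ a
  ≈-refl {sort s}  = sort
  ≈-refl {var i}   = var
  ≈-refl {app v t} = app ≈-refl ≈-refl
  ≈-refl {lam w t} = lam (λ _ → ≈-refl) ≈-refl

  ≈-sym : ∀ {a b} → a ≈ b → b ≈ a
  ≈-sym sort      = sort
  ≈-sym var       = var
  ≈-sym (app p q) = app (≈-sym p) (≈-sym q)
  ≈-sym (lam p q) = lam (λ k → ≈-sym (p k)) (≈-sym q)

  ≈-trans : ∀ {a b c} → a ≈ b → b ≈ c → a ≈ c
  ≈-trans sort      sort        = sort
  ≈-trans var       var         = var
  ≈-trans (app p q) (app p' q') = app (≈-trans p p') (≈-trans q q')
  ≈-trans (lam p q) (lam p' q') = lam (λ k → ≈-trans (p k) (p' k)) (≈-trans q q')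

  ≈-reflexive : ∀ {a b} → a ≡ b → a ≈ b
  ≈-reflexive refl = ≈-refl

  -- Substitution calculus for pure terms

  renP : (ℕ → ℕ) → Pure S → Pure S
  renP f (sort s)  = sort s
  renP f (var i)   = var (f i)
  renP f (app v t) = app (renP f v) (renP f t)
  renP f (lam w t) = lam (λ k → renP f (w k)) (renP (ext f) t)

  extP : (ℕ → Pure S) → ℕ → Pure S
  extP σ zero    = var 0
  extP σ (suc i) = renP suc (σ i)

  subP : (ℕ → Pure S) → Pure S → Pure S
  subP σ (sort s)  = sort s
  subP σ (var i)   = σ i
  subP σ (app v t) = app (subP σ v) (subP σ t)
  subP σ (lam w t) = lam (λ k → subP σ (w k)) (subP (extP σ) t)

  inst : Pure S → Pure S → Pure S
  inst v = subP (cons v var)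

  renP-resp : ∀ {f a b} → a ≈ b → renP f a ≈ renP f b
  renP-resp sort      = sort
  renP-resp var       = var
  renP-resp (app p q) = app (renP-resp p) (renP-resp q)
  renP-resp (lam p q) = lam (λ k → renP-resp (p k)) (renP-resp q)

  extP-resp : ∀ {σ τ} → (∀ i → σ i ≈ τ i) → ∀ i → extP σ i ≈ extP τ i
  extP-resp r zero    = var
  extP-resp r (suc i) = renP-resp (r i)

  subP-resp : ∀ {σ τ a b} → a ≈ b → (∀ i → σ i ≈ τ i) → subP σ a ≈ subP τ b
  subP-resp sort      r = sort
  subP-resp var       r = r _
  subP-resp (app p q) r = app (subP-resp p r) (subP-resp q r)
  subP-resp (lam p q) r = lam (λ k → subP-resp (p k) r) (subP-resp q (extP-resp r))

  -- The composite is a parameter given by a pointwise equation, so passing a binder only extends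
  -- that equation and needs no function extensionality. The fusion laws below have the same form.
  renP-renP : ∀ a {f g h} → g ∘ f ≗ h → renP g (renP f a) ≈ renP h a
  renP-renP (sort s)  r = sort
  renP-renP (var i)   r = ≈-reflexive (cong var (r i))
  renP-renP (app v t) r = app (renP-renP v r) (renP-renP t r)
  renP-renP (lam w t) r = lam (λ k → renP-renP (w k) r) (renP-renP t (ext-∘ r))

  subP-renP : ∀ a {f σ τ} → (∀ i → σ (f i) ≈ τ i) → subP σ (renP f a) ≈ subP τ a
  subP-renP (sort s)  r = sort
  subP-renP (var i)   r = r i
  subP-renP (app v t) r = app (subP-renP v r) (subP-renP t r)
  subP-renP (lam w t) r = lam (λ k → subP-renP (w k) r)
    (subP-renP t λ { zero → var ; (suc i) → renP-resp (r i) })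

  renP-subP : ∀ a {f σ τ} → (∀ i → renP f (σ i) ≈ τ i) → renP f (subP σ a) ≈ subP τ a
  renP-subP (sort s)  r = sort
  renP-subP (var i)   r = r i
  renP-subP (app v t) r = app (renP-subP v r) (renP-subP t r)
  renP-subP (lam w t) {f} {σ} r = lam (λ k → renP-subP (w k) r)
    (renP-subP t λ { zero    → var
                   -- `ext f` after `suc` and `suc` after `f` both rename along `suc ∘ f`.
                   ; (suc i) → ≈-trans (renP-renP (σ i) (λ _ → refl))
                       (≈-trans (≈-sym (renP-renP (σ i) (λ _ → refl))) (renP-resp (r i))) })

  subP-extP : ∀ a σ → subP (extP σ) (renP suc a) ≈ renP suc (subP σ a)
  subP-extP a σ = ≈-trans (subP-renP a (λ _ → ≈-refl)) (≈-sym (renP-subP a (λ _ → ≈-refl)))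

  subP-subP : ∀ a {σ τ υ} → (∀ i → subP τ (σ i) ≈ υ i) → subP τ (subP σ a) ≈ subP υ a
  subP-subP (sort s)  r = sort
  subP-subP (var i)   r = r i
  subP-subP (app v t) r = app (subP-subP v r) (subP-subP t r)
  subP-subP (lam w t) {σ} {τ} r = lam (λ k → subP-subP (w k) r)
    (subP-subP t λ { zero    → var
                   ; (suc i) → ≈-trans (subP-extP (σ i) τ) (renP-resp (r i)) })

  subP-id : ∀ a {σ} → (∀ i → σ i ≈ var i) → subP σ a ≈ a
  subP-id (sort s)  r = sort
  subP-id (var i)   r = r i
  subP-id (app v t) r = app (subP-id v r) (subP-id t r)
  subP-id (lam w t) r = lam (λ k → subP-id (w k) r)
    (subP-id t λ { zero → var ; (suc i) → renP-resp (r i) })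

  subP-var : ∀ f a → subP (var ∘ f) a ≈ renP f a
  subP-var f a = ≈-trans (≈-sym (subP-renP a (λ _ → ≈-refl))) (subP-id (renP f a) (λ _ → ≈-refl))

  inst-weaken : ∀ v a → inst v (renP suc a) ≈ a
  inst-weaken v a = ≈-trans (subP-renP a (λ _ → ≈-refl)) (subP-id a (λ _ → ≈-refl))

  renP-inst : ∀ f v t → renP f (inst v t) ≈ inst (renP f v) (renP (ext f) t)
  renP-inst f v t = ≈-trans (renP-subP t (λ _ → ≈-refl))
    (≈-sym (subP-renP t λ { zero → ≈-refl ; (suc i) → var }))

  subP-inst : ∀ σ v t → subP σ (inst v t) ≈ inst (subP σ v) (subP (extP σ) t)
  subP-inst σ v t = ≈-trans (subP-subP t (λ _ → ≈-refl))
    (≈-sym (subP-subP t λ { zero → ≈-refl ; (suc i) → inst-weaken (subP σ v) (σ i) }))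

  -- Parallel β-reduction, closed under ≈ on the right by the premise of beta.
  data _⇉_ : Pure S → Pure S → Set where
    sort : ∀ {s} → sort s ⇉ sort s
    var  : ∀ {i} → var i ⇉ var i
    app  : ∀ {v v' t t'} → v ⇉ v' → t ⇉ t' → app v t ⇉ app v' t'
    lam  : ∀ {w w' t t'} → (∀ k → w k ⇉ w' k) → t ⇉ t' → lam w t ⇉ lam w' t'
    beta : ∀ {v v' w t t' r} → v ⇉ v' → t ⇉ t' → inst v' t' ≈ r → app v (lam w t) ⇉ r

  ≈⇒⇉ : ∀ {a b} → a ≈ b → a ⇉ b
  ≈⇒⇉ sort      = sort
  ≈⇒⇉ var       = var
  ≈⇒⇉ (app p q) = app (≈⇒⇉ p) (≈⇒⇉ q)
  ≈⇒⇉ (lam p q) = lam (λ k → ≈⇒⇉ (p k)) (≈⇒⇉ q)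

  ⇉-refl : ∀ {a} → a ⇉ a
  ⇉-refl = ≈⇒⇉ ≈-refl

  ⇉-respʳ : ∀ {a b c} → a ⇉ b → b ≈ c → a ⇉ c
  ⇉-respʳ sort         sort        = sort
  ⇉-respʳ var          var         = var
  ⇉-respʳ (app p q)    (app p' q') = app (⇉-respʳ p p') (⇉-respʳ q q')
  ⇉-respʳ (lam p q)    (lam p' q') = lam (λ k → ⇉-respʳ (p k) (p' k)) (⇉-respʳ q q')
  ⇉-respʳ (beta p q e) e'          = beta p q (≈-trans e e')

  ⇉-respˡ : ∀ {a b c} → a ≈ b → b ⇉ c → a ⇉ c
  ⇉-respˡ sort              sort         = sort
  ⇉-respˡ var               var          = var
  ⇉-respˡ (app p q)         (app p' q')  = app (⇉-respˡ p p') (⇉-respˡ q q')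
  ⇉-respˡ (lam p q)         (lam p' q')  = lam (λ k → ⇉-respˡ (p k) (p' k)) (⇉-respˡ q q')
  ⇉-respˡ (app p (lam _ q)) (beta r s e) = beta (⇉-respˡ p r) (⇉-respˡ q s) e

  ⇉-renP : ∀ {a b} f → a ⇉ b → renP f a ⇉ renP f b
  ⇉-renP f sort      = sort
  ⇉-renP f var       = var
  ⇉-renP f (app p q) = app (⇉-renP f p) (⇉-renP f q)
  ⇉-renP f (lam p q) = lam (λ k → ⇉-renP f (p k)) (⇉-renP (ext f) q)
  ⇉-renP f (beta {v' = v} {t' = t} p q e) = beta (⇉-renP f p) (⇉-renP (ext f) q)
    (≈-trans (≈-sym (renP-inst f v t)) (renP-resp e))

  ⇉-subP : ∀ {a b σ τ} → a ⇉ b → (∀ i → σ i ⇉ τ i) → subP σ a ⇉ subP τ b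
  ⇉-extP : ∀ {σ τ} → (∀ i → σ i ⇉ τ i) → ∀ i → extP σ i ⇉ extP τ i
  ⇉-extP r zero    = var
  ⇉-extP r (suc i) = ⇉-renP suc (r i)
  ⇉-subP sort      r = sort
  ⇉-subP var       r = r _
  ⇉-subP (app p q) r = app (⇉-subP p r) (⇉-subP q r)
  ⇉-subP (lam p q) r = lam (λ k → ⇉-subP (p k) r) (⇉-subP q (⇉-extP r))
  ⇉-subP {τ = τ} (beta {v' = v} {t' = t} p q e) r = beta (⇉-subP p r) (⇉-subP q (⇉-extP r))
    (≈-trans (≈-sym (subP-inst τ v t)) (subP-resp e (λ _ → ≈-refl)))

  ⇉-inst : ∀ {v v' t t'} → v ⇉ v' → t ⇉ t' → inst v t ⇉ inst v' t'
  ⇉-inst p q = ⇉-subP q λ { zero → p ; (suc i) → var }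

  -- Confluence by complete developments

  develop : Pure S → Pure S
  develop (sort s)          = sort s
  develop (var i)           = var i
  develop (app v (lam w t)) = inst (develop v) (develop t)
  develop (app v t)         = app (develop v) (develop t)
  develop (lam w t)         = lam (λ k → develop (w k)) (develop t)

  -- Takahashi's triangle property: the redexes of `a` left uncontracted in `b` can still be
  -- contracted, so `develop a` joins all parallel reducts of `a`.
  ⇉-develop : ∀ {a b} → a ⇉ b → b ⇉ develop a
  ⇉-develop sort      = sort
  ⇉-develop var       = var
  ⇉-develop (app {t = sort _}  p q) = app (⇉-develop p) (⇉-develop q)
  ⇉-develop (app {t = var _}   p q) = app (⇉-develop p) (⇉-develop q)
  ⇉-develop (app {t = app _ _} p q) = app (⇉-develop p) (⇉-develop q)
  ⇉-develop (app {t = lam _ _} p (lam _ q)) = beta (⇉-develop p) (⇉-develop q) ≈-refl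
  ⇉-develop (lam p q)    = lam (λ k → ⇉-develop (p k)) (⇉-develop q)
  ⇉-develop (beta p q e) = ⇉-respˡ (≈-sym e) (⇉-inst (⇉-develop p) (⇉-develop q))

  -- Convertibility of sequences: each step reduces all members at once, since
  -- members converted separately might need unboundedly many steps.

  _⇛_ : (s t : ℕ → Pure S) → Set
  s ⇛ t = ∀ k → s k ⇉ t k

  infix 4 _≃_
  _≃_ : (s t : ℕ → Pure S) → Set
  _≃_ = EqClosure _⇛_

  -- The peak of `p` and the first step `q` is closed by `develop` in all members at once; its far
  -- side is then moved along the remaining steps.
  strip : ∀ {s t u} → s ⇛ t → Star _⇛_ s u → ∃[ r ] Star _⇛_ t r × u ⇛ r
  strip p ε = _ , ε , p
  strip p (q ◅ qs) with strip (λ k → ⇉-develop (q k)) qs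
  ... | r , rs , e = r , (λ k → ⇉-develop (p k)) ◅ rs , e

  -- Only a backward step needs confluence: it forms a peak with the reduction found so far, which
  -- `strip` closes.
  church-rosser : ∀ {s t} → s ≃ t → ∃[ r ] Star _⇛_ s r × Star _⇛_ t r
  church-rosser ε = _ , ε , ε
  church-rosser (fwd p ◅ c) with church-rosser c
  ... | r , x , y = r , p ◅ x , y
  church-rosser (bwd p ◅ c) with church-rosser c
  ... | r , x , y with strip p x
  ... | r' , x' , z = r' , x' , y ◅◅ (z ◅ ε)

  -- Reduction never destroys a leading abstraction. Member 0 suffices, since its annotation is a
  -- whole sequence and reduces as such.
  lam-⇛* : ∀ {w a s r} → s 0 ≈ lam w a → Star _⇛_ s r →
    ∃[ w' ] ∃[ a' ] Star _⇛_ w w' × r 0 ≈ lam w' a'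
  lam-⇛* e ε        = _ , _ , ε , e
  lam-⇛* e (p ◅ ps) = step (⇉-respˡ (≈-sym e) (p 0)) refl ps
    where
    -- Member 0 of the reduct is generalised to a variable `b`, so that the parallel step can be
    -- matched.
    step : ∀ {w a s r b} → lam w a ⇉ b → s 0 ≡ b → Star _⇛_ s r →
      ∃[ w' ] ∃[ a' ] Star _⇛_ w w' × r 0 ≈ lam w' a'
    step (lam p _) eq ps with lam-⇛* (≈-reflexive eq) ps
    ... | w' , a' , qs , e' = w' , a' , p ◅ qs , e'

  ≃-sym : ∀ {s t} → s ≃ t → t ≃ s
  ≃-sym = Eq.symmetric _⇛_

  ⇛⇒≃ : ∀ {s t} → s ⇛ t → s ≃ t
  ⇛⇒≃ p = fwd p ◅ ε

  ≈⇒≃ : ∀ {s t} → (∀ k → s k ≈ t k) → s ≃ t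
  ≈⇒≃ p = ⇛⇒≃ (λ k → ≈⇒⇉ (p k))

  ≗⇒≃ : ∀ {s t} → s ≗ t → s ≃ t
  ≗⇒≃ p = ≈⇒≃ (λ k → ≈-reflexive (p k))

  ⇛*⇒≃ : ∀ {s t} → Star _⇛_ s t → s ≃ t
  ⇛*⇒≃ = Star.map fwd

  -- At a common reduct member 0 is still an abstraction, whose annotation is reached from both `w`
  -- and `w'`. Hence all iterated types of the two domains are convertible.
  lam-injˡ : ∀ {w w' u u' : ℕ → Pure S} → (λ k → lam w (u k)) ≃ (λ k → lam w' (u' k)) → w ≃ w'
  lam-injˡ c with church-rosser c
  ... | r , x , y with r 0 | lam-⇛* ≈-refl x | lam-⇛* ≈-refl y
  ... | lam _ _ | w₁ , _ , x' , lam e _ | w₂ , _ , y' , lam e' _ =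
    ⇛*⇒≃ x' ◅◅ ≈⇒≃ (λ k → ≈-trans (≈-sym (e k)) (e' k)) ◅◅ ≃-sym (⇛*⇒≃ y')

  -- Congruence of convertibility

  drop-cong : ∀ m {s t} → s ≃ t → drop m s ≃ drop m t
  drop-cong m = Eq.gmap (drop m) (λ p k → p (m + k))

  app-cong : ∀ {v v' s s'} → v ≃ v' → s ≃ s' →
    (λ k → app (v 0) (s k)) ≃ (λ k → app (v' 0) (s' k))
  app-cong {s = s} c d =
    Eq.gmap (λ v k → app (v 0) (s k)) (λ p k → app (p 0) ⇉-refl) c
    ◅◅ Eq.gmap (λ s k → app _ (s k)) (λ p k → app ⇉-refl (p k)) d

  lam-cong : ∀ {w w' s s'} → w ≃ w' → s ≃ s' →
    (λ k → lam w (s k)) ≃ (λ k → lam w' (s' k))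
  lam-cong {s = s} c d =
    Eq.gmap (λ w k → lam w (s k)) (λ p k → lam p ⇉-refl) c
    ◅◅ Eq.gmap (λ s k → lam _ (s k)) (λ p k → lam (λ _ → ⇉-refl) (p k)) d

  cons-cong : ∀ {v v' s s'} → v ≃ v' → s ≃ s' → cons (v 0) s ≃ cons (v' 0) s'
  cons-cong {s = s} c d =
    Eq.gmap (λ v → cons (v 0) s) (λ p → λ { zero → p 0 ; (suc k) → ⇉-refl }) c
    ◅◅ Eq.gmap (λ s → cons _ s) (λ p → λ { zero → ⇉-refl ; (suc k) → p k }) d

  mapP : (Pure S → Pure S) → (ℕ → Pure S) → ℕ → Pure S
  mapP h s k = h (s k)

  renP-cong : ∀ f {s t} → s ≃ t → mapP (renP f) s ≃ mapP (renP f) t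
  renP-cong f = Eq.gmap (mapP (renP f)) (λ p k → ⇉-renP f (p k))

  subP-cong : ∀ σ {s t} → s ≃ t → mapP (subP σ) s ≃ mapP (subP σ) t
  subP-cong σ = Eq.gmap (mapP (subP σ)) (λ p k → ⇉-subP (p k) (λ _ → ⇉-refl))

-- Interpretation of terms

module _ {S : Set} where

  -- A variable declared of type W stands for itself followed by W, its type,
  -- and the iterated types of W; a defined variable stands for its value, so
  -- that definitions bind no pure variable.

  new : Bind → (ℕ → Pure S) → ℕ → Pure S
  new abst s = cons (var 0) (mapP (renP suc) s)
  new abbr s = s

  weaken : Bind → (ℕ → Pure S) → ℕ → Pure S
  weaken abst = mapP (renP suc)
  weaken abbr = id

  extend : Bind → (ℕ → Pure S) → (ℕ → ℕ → Pure S) → ℕ → ℕ → Pure S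
  extend b s ρ = cons (new b s) (weaken b ∘ ρ)

  extPᵇ : Bind → (ℕ → Pure S) → ℕ → Pure S
  extPᵇ abst = extP
  extPᵇ abbr = id

  extend-cong : ∀ b {σ f g s s' ρ ρ'} → mapP (subP σ) s ≃ s' →
    (∀ i → mapP (subP σ) (ρ (f i)) ≃ ρ' (g i)) →
    ∀ i → mapP (subP (extPᵇ b σ)) (extend b s ρ (ext f i)) ≃ extend b s' ρ' (ext g i)
  extend-cong abst {σ} {s = s} c h zero =
    ≈⇒≃ {t = new abst (mapP (subP σ) s)} (λ { zero → var ; (suc k) → subP-extP (s k) σ })
    ◅◅ cons-cong {v = λ _ → var 0} ε (renP-cong suc c)
  extend-cong abst {σ} {f} {ρ = ρ} c h (suc i) =
    ≈⇒≃ (λ k → subP-extP (ρ (f i) k) σ) ◅◅ renP-cong suc (h i)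
  extend-cong abbr c h zero    = c
  extend-cong abbr c h (suc i) = h i

module _ {S : Set} (next : S → S) where

  -- Iterating from the inside makes dropping the first member of a sort's sequence agree
  -- definitionally with applying `next`.
  orbit : S → ℕ → S
  orbit s zero    = s
  orbit s (suc k) = orbit (next s) k

  ⟦_⟧ : Term S → (ℕ → ℕ → Pure S) → ℕ → Pure S
  ⟦ sort s ⟧        ρ k = sort (orbit s k)
  ⟦ lref i ⟧        ρ   = ρ i
  ⟦ appl V T ⟧      ρ k = app (⟦ V ⟧ ρ 0) (⟦ T ⟧ ρ k)
  ⟦ bind abst W T ⟧ ρ k = lam (⟦ W ⟧ ρ) (⟦ T ⟧ (extend abst (⟦ W ⟧ ρ) ρ) k)
  ⟦ bind abbr V T ⟧ ρ   = ⟦ T ⟧ (extend abbr (⟦ V ⟧ ρ) ρ)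
  ⟦ cast U T ⟧      ρ   = cons (⟦ T ⟧ ρ 0) (⟦ U ⟧ ρ)

  -- One induction serves several purposes: `f = id` and `g = suc` give weakening, while
  -- `f = g = id` gives β-substitution and congruence.
  ⟦⟧-map : ∀ T {f g ρ ρ' σ} → (∀ i → mapP (subP σ) (ρ (f i)) ≃ ρ' (g i)) →
    mapP (subP σ) (⟦ ren f T ⟧ ρ) ≃ ⟦ ren g T ⟧ ρ'
  ⟦⟧-map (sort s)        h = ε
  ⟦⟧-map (lref i)        h = h i
  ⟦⟧-map (appl V T)      h = app-cong (⟦⟧-map V h) (⟦⟧-map T h)
  ⟦⟧-map (bind abst W T) h =
    lam-cong (⟦⟧-map W h) (⟦⟧-map T (extend-cong abst (⟦⟧-map W h) h))
  ⟦⟧-map (bind abbr V T) h = ⟦⟧-map T (extend-cong abbr (⟦⟧-map V h) h)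
  ⟦⟧-map (cast U T)      h =
    ≗⇒≃ (λ { zero → refl ; (suc k) → refl }) ◅◅ cons-cong (⟦⟧-map T h) (⟦⟧-map U h)

  weakenP : Bind → ℕ → Pure S
  weakenP abst i = var (suc i)
  weakenP abbr i = var i

  subP-weakenP : ∀ b s → mapP (subP (weakenP b)) s ≃ weaken b s
  subP-weakenP abst s = ≈⇒≃ (λ k → subP-var suc (s k))
  subP-weakenP abbr s = ≈⇒≃ (λ k → subP-id (s k) (λ _ → var))

  subP-var≃ : ∀ s → mapP (subP var) s ≃ s
  subP-var≃ = subP-weakenP abbr

  ⟦⟧-map-id : ∀ T {ρ ρ' σ} → (∀ i → mapP (subP σ) (ρ i) ≃ ρ' i) →
    mapP (subP σ) (⟦ T ⟧ ρ) ≃ ⟦ T ⟧ ρ'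
  ⟦⟧-map-id T {ρ} {ρ'} {σ} h =
    subst (λ X → mapP (subP σ) (⟦ X ⟧ ρ) ≃ ⟦ X ⟧ ρ') (ren-id T (λ _ → refl)) (⟦⟧-map T {id} {id} h)

  -- The case of the identity substitution, which spares a separate induction.
  ⟦⟧-cong : ∀ T {ρ ρ'} → (∀ i → ρ i ≃ ρ' i) → ⟦ T ⟧ ρ ≃ ⟦ T ⟧ ρ'
  ⟦⟧-cong T h = ≃-sym (subP-var≃ _) ◅◅ ⟦⟧-map-id T (λ i → subP-var≃ _ ◅◅ h i)

  ⟦⟧-↑ : ∀ b T {s ρ} → ⟦ ↑ T ⟧ (extend b s ρ) ≃ weaken b (⟦ T ⟧ ρ)
  ⟦⟧-↑ b T {s} {ρ} rewrite ↑≡ren T =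
    ≃-sym (⟦⟧-map T {id} {suc} (λ i → subP-weakenP b (ρ i)))
    ◅◅ subst (λ X → mapP (subP (weakenP b)) (⟦ X ⟧ ρ) ≃ weaken b (⟦ T ⟧ ρ))
         (sym (ren-id T (λ _ → refl))) (subP-weakenP b _)

  weaken-cong : ∀ b {s t : ℕ → Pure S} → s ≃ t → weaken b s ≃ weaken b t
  weaken-cong abst = renP-cong suc
  weaken-cong abbr = id

  weaken-drop : ∀ b m (s : ℕ → Pure S) → weaken b (drop m s) ≃ drop m (weaken b s)
  weaken-drop abst m s = ε
  weaken-drop abbr m s = ε

  extend-congˡ : ∀ b {s s' : ℕ → Pure S} {ρ} → s ≃ s' → ∀ i → extend b s ρ i ≃ extend b s' ρ i
  extend-congˡ abst c zero    = cons-cong {v = λ _ → var 0} ε (renP-cong suc c)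
  extend-congˡ abbr c zero    = c
  extend-congˡ b    c (suc i) = ε

  -- Semantic counterpart of validity; G i is the soundness of variable i.
  Sound : (ℕ → ℕ → Pure S) → (ℕ → Set) → Term S → Set
  Sound ρ G (sort s)     = ⊤
  Sound ρ G (lref i)     = G i
  Sound ρ G (appl V T)   = Sound ρ G V × Sound ρ G T ×
    Σ ℕ λ n → Σ (ℕ → Pure S) λ w → Σ (ℕ → Pure S) λ u →
      drop n (⟦ T ⟧ ρ) ≃ (λ k → lam w (u k)) × w ≃ drop 1 (⟦ V ⟧ ρ)
  Sound ρ G (bind b V T) =
    Sound ρ G V × Sound (extend b (⟦ V ⟧ ρ) ρ) (cons (Sound ρ G V) G) T
  Sound ρ G (cast U T)   = Sound ρ G U × Sound ρ G T × ⟦ U ⟧ ρ ≃ drop 1 (⟦ T ⟧ ρ)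

  -- Soundness under renaming and substitution

  Sound-map : ∀ T {f g ρ ρ' G G' σ} → (∀ i → mapP (subP σ) (ρ (f i)) ≃ ρ' (g i)) →
    (∀ i → G (f i) → G' (g i)) → Sound ρ G (ren f T) → Sound ρ' G' (ren g T)
  Sound-map (sort s)   h k _ = tt
  Sound-map (lref i)   h k x = k i x
  Sound-map (appl V T) {σ = σ} h k (v , t , n , w , u , c , d) =
    Sound-map V h k v , Sound-map T h k t ,
    -- The stored conversions are transported by `σ`; the members of `u` lie under the abstraction,
    -- hence `extP σ`.
    n , mapP (subP σ) w , mapP (subP (extP σ)) u ,
    ≃-sym (drop-cong n (⟦⟧-map T h)) ◅◅ subP-cong σ c ,
    subP-cong σ d ◅◅ drop-cong 1 (⟦⟧-map V h)
  Sound-map (bind b V T) h k (v , t) =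
    Sound-map V h k v ,
    Sound-map T (extend-cong b (⟦⟧-map V h) h)
      (λ { zero x → Sound-map V h k x ; (suc i) → k i }) t
  Sound-map (cast U T) {σ = σ} h k (u , t , c) =
    Sound-map U h k u , Sound-map T h k t ,
    ≃-sym (⟦⟧-map U h) ◅◅ subP-cong σ c ◅◅ drop-cong 1 (⟦⟧-map T h)

  Sound-map-id : ∀ T {ρ ρ' G G' σ} → (∀ i → mapP (subP σ) (ρ i) ≃ ρ' i) →
    (∀ i → G i → G' i) → Sound ρ G T → Sound ρ' G' T
  Sound-map-id T h k x = subst (Sound _ _) (ren-id T (λ _ → refl))
    (Sound-map T {id} {id} h k (subst (Sound _ _) (sym (ren-id T (λ _ → refl))) x))

  Sound-cong : ∀ T {ρ ρ' G G'} → (∀ i → ρ i ≃ ρ' i) → (∀ i → G i → G' i) →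
    Sound ρ G T → Sound ρ' G' T
  Sound-cong T h = Sound-map-id T (λ i → subP-var≃ _ ◅◅ h i)

  Sound-↑ : ∀ b T {s ρ G A} → Sound ρ G T → Sound (extend b s ρ) (cons A G) (↑ T)
  Sound-↑ b T {ρ = ρ} x rewrite ↑≡ren T =
    Sound-map T {id} {suc} (λ i → subP-weakenP b (ρ i)) (λ _ → id)
      (subst (Sound _ _) (sym (ren-id T (λ _ → refl))) x)

  -- Serves `zeta`: a definition binds no pure variable, so removing it leaves the pure terms in
  -- place.
  Sound-↑⁻¹ : ∀ T {s ρ G A} → Sound (extend abbr s ρ) (cons A G) (↑ T) → Sound ρ G T
  Sound-↑⁻¹ T {ρ = ρ} x rewrite ↑≡ren T = subst (Sound _ _) (ren-id T (λ _ → refl))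
    (Sound-map T {suc} {id} (λ i → subP-var≃ (ρ i)) (λ _ → id) x)

  -- β-contraction replaces the declaration x : W by x = cast(W,V).
  extend-beta : ∀ (V W : Term S) {ρ} i →
    mapP (subP (cons (⟦ V ⟧ ρ 0) var)) (extend abst (⟦ W ⟧ ρ) ρ i)
    ≃ extend abbr (⟦ cast W V ⟧ ρ) ρ i
  extend-beta V W {ρ} zero    = ≈⇒≃ λ { zero → ≈-refl ; (suc k) → inst-weaken _ (⟦ W ⟧ ρ k) }
  extend-beta V W {ρ} (suc i) = ≈⇒≃ λ k → inst-weaken _ (ρ i k)

  -- Subject reduction

  env : Env S → ℕ → ℕ → Pure S
  -- A default: an index outside the environment admits no step and stands for itself at every
  -- level.
  env ⋆            i k = var i
  env (L ,[ b ] V)     = extend b (⟦ V ⟧ (env L)) (env L)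

  soundVar : Env S → ℕ → Set
  soundVar ⋆            i = ⊤
  soundVar (L ,[ b ] V)   = cons (Sound (env L) (soundVar L) V) (soundVar L)

  SoundIn : Env S → Term S → Set
  SoundIn L = Sound (env L) (soundVar L)

  -- Soundness enters at casts: `epsilon` and `castE` change the component from which members are
  -- read, and the conversion stored at the cast bridges the two.
  Step-⟦⟧ : ∀ {L m T T'} → Step next L m T T' → SoundIn L T →
    ⟦ T' ⟧ (env L) ≃ drop m (⟦ T ⟧ (env L))
  Step-⟦⟧ (beta {V = V} {W} {T}) _ =
    -- In each member the unfolded definition is the contractum of the pure β-redex.
    ≃-sym (⟦⟧-map-id T (extend-beta V W)) ◅◅ ≃-sym (⇛⇒≃ λ k → beta ⇉-refl ⇉-refl ≈-refl)
  Step-⟦⟧ (delta {V = V}) _    = ⟦⟧-↑ abbr V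
  Step-⟦⟧ (zeta {T = T})  _    = ≃-sym (⟦⟧-↑ abbr T)
  Step-⟦⟧ (theta {V = V}) _    = app-cong (⟦⟧-↑ abbr V) ε
  Step-⟦⟧ {L} (epsilon {U = U} {T}) (_ , _ , c) =
    ≗⇒≃ (λ { zero → refl ; (suc k) → refl }) ◅◅ cons-cong {v = ⟦ T ⟧ (env L)} ε (≃-sym c)
  Step-⟦⟧ sortS           _    = ε
  Step-⟦⟧ (ldec {W = W})  _    = ⟦⟧-↑ abst W
  Step-⟦⟧ ee              _    = ε
  Step-⟦⟧ (lift {K} {b} {n = m} {T} r) x =
    ⟦⟧-↑ b T ◅◅ weaken-cong b (Step-⟦⟧ r x) ◅◅ weaken-drop b m _
  Step-⟦⟧ (applV r) (v , _)     = app-cong (Step-⟦⟧ r v) ε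
  Step-⟦⟧ {L} (applT {V = V} r) (_ , t , _) =
    app-cong {v = ⟦ V ⟧ (env L)} ε (Step-⟦⟧ r t)
  Step-⟦⟧ (bindV {b = abst} {T = T} r) (v , _) =
    lam-cong (Step-⟦⟧ r v) (⟦⟧-cong T (extend-congˡ abst (Step-⟦⟧ r v)))
  Step-⟦⟧ (bindV {b = abbr} {T = T} r) (v , _) =
    ⟦⟧-cong T (extend-congˡ abbr (Step-⟦⟧ r v))
  Step-⟦⟧ (bindT {b = abst} r) (_ , t) = lam-cong ε (Step-⟦⟧ r t)
  Step-⟦⟧ (bindT {b = abbr} r) (_ , t) = Step-⟦⟧ r t
  Step-⟦⟧ {L} (castU {T = T} r) (u , _) = cons-cong {v = ⟦ T ⟧ (env L)} ε (Step-⟦⟧ r u)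
  Step-⟦⟧ (castT r) (_ , t , _) = cons-cong (Step-⟦⟧ r t) ε
  Step-⟦⟧ (castE r q) (u , t , c) =
    -- The target is all of `⟦ U₁ ⟧`: its head comes from `T₂` through the stored conversion, its
    -- tail from `U₂`.
    cons-cong (Step-⟦⟧ q t ◅◅ ≃-sym c) (Step-⟦⟧ r u) ◅◅ ≗⇒≃ λ { zero → refl ; (suc k) → refl }

  drop-drop : ∀ {A : Set} m n (s : ℕ → A) → drop m (drop n s) ≗ drop n (drop m s)
  drop-drop m n s k = cong s (trans (sym (+-assoc n m k))
    (trans (cong (_+ k) (+-comm n m)) (+-assoc m n k)))

  Step-Sound : ∀ {L m T T'} → Step next L m T T' → SoundIn L T → SoundIn L T'
  -- Dropping `n` members leaves the annotation `⟦ W ⟧` intact, so `lam-injˡ` gives the conversion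
  -- that the new cast requires.
  Step-Sound {L} (beta {V = V} {W} {T}) (v , (w , t) , n , _ , _ , c , d) = s ,
    Sound-map-id T (extend-beta V W) (λ { zero _ → s ; (suc i) → id }) t
    where s = w , v , lam-injˡ c ◅◅ d
  Step-Sound (delta {V = V}) x           = Sound-↑ abbr V x
  Step-Sound (zeta {T = T}) (_ , t)      = Sound-↑⁻¹ T t
  Step-Sound (theta {V = V}) (v , (w , t) , n , w' , u' , c , d) =
    w , Sound-↑ abbr V v , t , n , w' , u' , c , d ◅◅ drop-cong 1 (≃-sym (⟦⟧-↑ abbr V))
  Step-Sound epsilon (_ , t , _)         = t
  Step-Sound sortS _                     = tt
  Step-Sound (ldec {W = W}) x            = Sound-↑ abst W x
  Step-Sound ee (u , _)                  = u
  Step-Sound (lift {b = b} {T = T} r) x  = Sound-↑ b T (Step-Sound r x)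
  Step-Sound (applV r) (v , t , n , w , u , c , d) =
    Step-Sound r v , t , n , w , u , c , d ◅◅ drop-cong 1 (≃-sym (Step-⟦⟧ r v))
  Step-Sound {L} (applT {T₁ = T} {n = m} r) (v , t , n , w , u , c , d) =
    -- The witness `n` is kept; the `m` members lost by the function are dropped from the bodies `u`
    -- instead.
    v , Step-Sound r t , n , w , drop m u ,
    drop-cong n (Step-⟦⟧ r t) ◅◅ ≗⇒≃ (drop-drop n m (⟦ T ⟧ (env L))) ◅◅ drop-cong m c , d
  Step-Sound (bindV {b = b} {T = T} r) (v , t) = Step-Sound r v ,
    Sound-cong T (extend-congˡ b (≃-sym (Step-⟦⟧ r v)))
      (λ { zero _ → Step-Sound r v ; (suc i) → id }) t
  Step-Sound (bindT r) (v , t)           = v , Step-Sound r t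
  Step-Sound (castU r) (u , t , c)       = Step-Sound r u , t , Step-⟦⟧ r u ◅◅ c
  Step-Sound (castT r) (u , t , c)       =
    u , Step-Sound r t , c ◅◅ drop-cong 1 (≃-sym (Step-⟦⟧ r t))
  Step-Sound (castE r q) (u , t , c)     = Step-Sound r u , Step-Sound q t ,
    Step-⟦⟧ r u ◅◅ drop-cong 1 c ◅◅ drop-cong 1 (≃-sym (Step-⟦⟧ q t))

  Steps-Sound : ∀ {L m T T'} → Steps next L m T T' → SoundIn L T →
    SoundIn L T' × ⟦ T' ⟧ (env L) ≃ drop m (⟦ T ⟧ (env L))
  Steps-Sound (inj r) x = Step-Sound r x , Step-⟦⟧ r x
  Steps-Sound refl*   x = x , ε
  Steps-Sound {L} (trans* {n₁ = m} {n} {T₁ = T} p q) x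
    with Steps-Sound p x
  ... | y , c with Steps-Sound q y
  ... | z , d = z , d ◅◅ drop-cong n c ◅◅
    ≗⇒≃ (λ k → cong (⟦ T ⟧ (env L)) (sym (+-assoc m n k)))

  -- The reductions demanded by validity start from sound subterms, so `Steps-Sound` turns them into
  -- conversions; at a cast these meet at the common reduct.
  Valid-Sound : ∀ {A L T} → Valid next A L T → SoundIn L T
  Valid-Sound vSort             = tt
  Valid-Sound (vZero v)         = Valid-Sound v
  Valid-Sound (vLift v)         = Valid-Sound v
  Valid-Sound (vBind v t)       = Valid-Sound v , Valid-Sound t
  Valid-Sound (vCast u t p q)   = Valid-Sound u , Valid-Sound t ,
    ≃-sym (proj₂ (Steps-Sound q (Valid-Sound u))) ◅◅ proj₂ (Steps-Sound p (Valid-Sound t))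
  Valid-Sound (vAppl {n = n} v t _ p q) = Valid-Sound v , Valid-Sound t , n , _ , _ ,
    ≃-sym (proj₂ (Steps-Sound p (Valid-Sound t))) , proj₂ (Steps-Sound q (Valid-Sound v))

-- Realization of unfolding and of pure β-reduction by 0-reduction

module _ {S : Set} (next : S → S) where

  infix 3 _⊢_↠_
  _⊢_↠_ : Env S → Term S → Term S → Set
  L ⊢ T ↠ T' = Star (Step next L 0) T T'

  ↠⇒Steps : ∀ {L T T'} → L ⊢ T ↠ T' → Steps next L 0 T T'
  ↠⇒Steps ε        = refl*
  ↠⇒Steps (r ◅ rs) = trans* (inj r) (↠⇒Steps rs)

  -- Stated through the steps of variables, since these are exactly the steps that consult the
  -- environment.
  Renaming : (ℕ → ℕ) → Env S → Env S → Set
  Renaming f L L' = ∀ {i n T} → Step next L n (lref i) T → Step next L' n (lref (f i)) (ren f T)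

  Renaming-ext : ∀ {f L L' b V} → Renaming f L L' →
    Renaming (ext f) (L ,[ b ] V) (L' ,[ b ] ren f V)
  Renaming-ext {f} h (delta {V = V}) rewrite ren-↑ f V = delta
  Renaming-ext {f} h (ldec {W = W})  rewrite ren-↑ f W = ldec
  Renaming-ext {f} h (lift {T = T} r) rewrite ren-↑ f T = lift (h r)

  Step-ren : ∀ {f L L' n T T'} → Renaming f L L' → Step next L n T T' →
    Step next L' n (ren f T) (ren f T')
  Step-ren h beta      = beta
  Step-ren h delta     = h delta
  Step-ren {f} h (zeta {T = T}) rewrite ren-↑ f T = zeta
  Step-ren {f} h (theta {V = V}) rewrite ren-↑ f V = theta
  Step-ren h epsilon   = epsilon
  Step-ren h sortS     = sortS
  Step-ren h ldec      = h ldec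
  Step-ren h ee        = ee
  Step-ren h (lift r)  = h (lift r)
  Step-ren h (applV r) = applV (Step-ren h r)
  Step-ren h (applT r) = applT (Step-ren h r)
  Step-ren h (bindV r) = bindV (Step-ren h r)
  Step-ren h (bindT r) = bindT (Step-ren (Renaming-ext h) r)
  Step-ren h (castU r) = castU (Step-ren h r)
  Step-ren h (castT r) = castT (Step-ren h r)
  Step-ren h (castE r q) = castE (Step-ren h r) (Step-ren h q)

  Renaming-suc : ∀ {L b V} → Renaming suc L (L ,[ b ] V)
  Renaming-suc {T = T} r = subst (Step next _ _ _) (↑≡ren T) (lift r)

  ↠-weaken : ∀ {L b V f T} X → L ⊢ T ↠ ren f X → L ,[ b ] V ⊢ ren suc T ↠ ren (suc ∘ f) X
  ↠-weaken {f = f} X r = subst (_ ⊢ _ ↠_) (ren-∘ X (λ _ → refl))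
    (Star.gmap (ren suc) (Step-ren Renaming-suc) r)

  ↠-appl : ∀ {L V V' T T'} → L ⊢ V ↠ V' → L ⊢ T ↠ T' → L ⊢ appl V T ↠ appl V' T'
  ↠-appl r q = Star.gmap (λ V → appl V _) applV r ◅◅ Star.gmap (appl _) applT q

  ↠-bind : ∀ {L b V V' T T'} → L ⊢ V ↠ V' → L ,[ b ] V ⊢ T ↠ T' → L ⊢ bind b V T ↠ bind b V' T'
  ↠-bind {b = b} r q = Star.gmap (bind b _) bindT q ◅◅ Star.gmap (λ V → bind b V _) bindV r

  ↠-zeta : ∀ {L V T f} X → L ,[ abbr ] V ⊢ T ↠ ren (suc ∘ f) X → L ⊢ bind abbr V T ↠ ren f X
  ↠-zeta {f = f} X r = ↠-bind ε (subst (_ ⊢ _ ↠_) (sym (↑-ren f X)) r) ◅◅ (zeta ◅ ε)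

  -- Of an annotation only member 0, the unfolded domain, becomes syntax; its iterated types serve
  -- convertibility.
  embed : Pure S → Term S
  embed (sort s)  = sort s
  embed (var i)   = lref i
  embed (app v t) = appl (embed v) (embed t)
  embed (lam w t) = bind abst (embed (w 0)) (embed t)

  embed-≈ : ∀ {a b} → a ≈ b → embed a ≡ embed b
  embed-≈ sort      = refl
  embed-≈ var       = refl
  embed-≈ (app p q) = cong₂ appl (embed-≈ p) (embed-≈ q)
  embed-≈ (lam p q) = cong₂ (bind abst) (embed-≈ (p 0)) (embed-≈ q)

  embed-renP : ∀ f a → embed (renP f a) ≡ ren f (embed a)
  embed-renP f (sort s)  = refl
  embed-renP f (var i)   = refl
  embed-renP f (app v t) = cong₂ appl (embed-renP f v) (embed-renP f t)
  embed-renP f (lam w t) = cong₂ (bind abst) (embed-renP f (w 0)) (embed-renP (ext f) t)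

  ↠-weaken-abst : ∀ {L b V f T} a → L ⊢ T ↠ ren f (embed a) →
    L ,[ b ] V ⊢ ren suc T ↠ ren (ext f) (embed (renP suc a))
  ↠-weaken-abst {f = f} a r = subst (_ ⊢ _ ↠_)
    (sym (trans (cong (ren (ext f)) (embed-renP suc a)) (ren-∘ (embed a) (λ _ → refl))))
    (↠-weaken (embed a) r)

  realize-subP : ∀ {L f g σ} a → (∀ i → L ⊢ lref (f i) ↠ ren g (embed (σ i))) →
    L ⊢ ren f (embed a) ↠ ren g (embed (subP σ a))
  realize-subP (sort s)  h = ε
  realize-subP (var i)   h = h i
  realize-subP (app v t) h = ↠-appl (realize-subP v h) (realize-subP t h)
  realize-subP {σ = σ} (lam w t) h = ↠-bind (realize-subP (w 0) h)
    (realize-subP t λ { zero → ε ; (suc i) → ↠-weaken-abst (σ i) (h i) })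

  -- Substitution by way of a definition: `delta` and `epsilon` put the value at each occurrence,
  -- then `zeta` discards the definition.
  realize-inst : ∀ {L f W} v t →
    L ⊢ bind abbr (cast W (ren f (embed v))) (ren (ext f) (embed t)) ↠ ren f (embed (inst v t))
  realize-inst {L} {f} {W} v t = ↠-zeta (embed (inst v t)) (realize-subP t λ
    { zero    → subst (L ,[ abbr ] cast W (ren f (embed v)) ⊢ lref 0 ↠_)
                  (↑-ren f (embed v)) (delta ◅ epsilon ◅ ε)
    ; (suc i) → ε })

  realize-⇉ : ∀ {L a b} f → a ⇉ b → L ⊢ ren f (embed a) ↠ ren f (embed b)
  realize-⇉ f sort      = ε
  realize-⇉ f var       = ε
  realize-⇉ f (app p q) = ↠-appl (realize-⇉ f p) (realize-⇉ f q)
  realize-⇉ f (lam p q) = ↠-bind (realize-⇉ f (p 0)) (realize-⇉ (ext f) q)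
  realize-⇉ f (beta {v' = v} {t' = t} p q e) =
    ↠-appl (realize-⇉ f p) (↠-bind ε (realize-⇉ (ext f) q))
    ◅◅ beta ◅ subst (λ X → _ ⊢ _ ↠ ren f X) (embed-≈ e) (realize-inst v t)

  realize-⇛* : ∀ {L s t} f → Star _⇛_ s t → L ⊢ ren f (embed (s 0)) ↠ ren f (embed (t 0))
  realize-⇛* f ε        = ε
  realize-⇛* f (p ◅ ps) = realize-⇉ f (p 0) ◅◅ realize-⇛* f ps

  -- Places pure variables in the environment: a definition occupies an index there but no pure
  -- variable, so it is skipped.
  extVar : Bind → (ℕ → ℕ) → ℕ → ℕ
  extVar abst f = ext f
  extVar abbr f = suc ∘ f

  Realizes : Env S → (ℕ → ℕ) → (ℕ → ℕ → Pure S) → Set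
  Realizes L f ρ = ∀ i → L ⊢ lref i ↠ ren f (embed (ρ i 0))

  Realizes-extend : ∀ {L f ρ s} b {V} → Realizes L f ρ → L ⊢ V ↠ ren f (embed (s 0)) →
    Realizes (L ,[ b ] V) (extVar b f) (extend b s ρ)
  Realizes-extend abst h r zero = ε
  Realizes-extend {ρ = ρ} abst h r (suc i) = ↠-weaken-abst (ρ i 0) (h i)
  Realizes-extend {s = s} abbr {V} h r zero =
    delta ◅ subst (_ ⊢_↠ _) (sym (↑≡ren V)) (↠-weaken (embed (s 0)) r)
  Realizes-extend {ρ = ρ} abbr h r (suc i) = ↠-weaken (embed (ρ i 0)) (h i)

  -- Follows the clauses of the interpretation at member 0: `epsilon` erases casts, and `zeta`
  -- removes a definition once its occurrences are unfolded.
  realize : ∀ {L f ρ} T → Realizes L f ρ → L ⊢ T ↠ ren f (embed (⟦ next ⟧ T ρ 0))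
  realize (sort s)        h = ε
  realize (lref i)        h = h i
  realize (appl V T)      h = ↠-appl (realize V h) (realize T h)
  realize (bind abst W T) h =
    ↠-bind (realize W h) (realize T (Realizes-extend abst h (realize W h)))
  realize (bind abbr V T) h =
    ↠-zeta (embed _) (realize T (Realizes-extend abbr h (realize V h)))
  realize (cast U T)      h = epsilon ◅ realize T h

  envVar : Env S → ℕ → ℕ
  envVar ⋆            = id
  envVar (L ,[ b ] V) = extVar b (envVar L)

  Realizes-env : ∀ L → Realizes L (envVar L) (env next L)
  Realizes-env ⋆            i = ε
  Realizes-env (L ,[ b ] V) = Realizes-extend b (Realizes-env L) (realize V (Realizes-env L))

  ≃⇒joinable : ∀ L U₁ U₂ → ⟦ next ⟧ U₁ (env next L) ≃ ⟦ next ⟧ U₂ (env next L) →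
    ∃[ U₀ ] L ⊢ U₁ ↠ U₀ × L ⊢ U₂ ↠ U₀
  ≃⇒joinable L U₁ U₂ c with church-rosser c
  ... | r , p , q = ren (envVar L) (embed (r 0)) ,
    realize U₁ (Realizes-env L) ◅◅ realize-⇛* (envVar L) p ,
    realize U₂ (Realizes-env L) ◅◅ realize-⇛* (envVar L) q

theorem5p4 : {S : Set} → S → DecidableEquality S → (next : S → S)
    → (A : ℕ → Set) (L : Env S) (T U₁ U₂ : Term S)
    → Typed next A L T U₁ → Typed next A L T U₂
    → Σ (Term S) (λ U₀ → Steps next L 0 U₁ U₀ × Steps next L 0 U₂ U₀)
theorem5p4 _ _ next A L T U₁ U₂ t₁ t₂ with Valid-Sound next t₁ | Valid-Sound next t₂
-- Both types are convertible to the sequence of `T` without its first member.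
... | _ , _ , c | _ , _ , d with ≃⇒joinable next L U₁ U₂ (c ◅◅ ≃-sym d)
... | U₀ , p , q = U₀ , ↠⇒Steps next p , ↠⇒Steps next q
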